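{- The deterministic query complexity of the HiddenPermutation problem with $n$ positions is $\Theta(n\log n)$. That is, if $D(n)$ denotes the minimum, over all deterministic strategies, of the worst-case number (over all secrets $(z,\pi)\in\{0,1\}^n\times S_n$) of queries required to identify the secret, then $D(n)=\Theta(n\log n)$ as $n\to\infty$.
   Context: $[n]=\{1,\dots,n\}$, $[0..n]=\{0,1,\dots,n\}$, and $S_n$ is the set of permutations of $[n]$. For $z\in\{0,1\}^n$ and $\pi\in S_n$ define $f_{z,\pi}:\{0,1\}^n\to[0..n]$ by $f_{z,\pi}(x)=\max\{i\in[0..n]\mid \forall j\le i:\ z_{\pi(j)}=x_{\pi(j)}\}$. HiddenPermutation problem: a secret pair $(z,\pi)\in\{0,1\}^n\times S_n$ is to be identified by adaptively asking queries $x^1,x^2,\ldots\in\{0,1\}^n$; the answer to query $x^i$ is the score $s^i=f_{z,\pi}(x^i)$. One may stop after $t$ queries if there is only a single pair $(z',\pi')\in\{0,1\}^n\times S_n$ with $f_{z',\pi'}(x^i)=s^i$ for all $1\le i\le t$; the secret is then identified. A deterministic strategy is a rooted tree of outdegree $n+1$ in which a query in $\{0,1\}^n$ is associated with every (internal) node. The search starts at the root; at a node, the associated query is asked and the search proceeds to the child selected by the score. The complexity of a strategy on input $(z,\pi)$ is the number of queries required to identify the secret; the complexity of a deterministic strategy is its worst-case complexity over all inputs. The deterministic query complexity is the minimum complexity of a deterministic strategy. -}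

module Defs where

open import Data.Bool.Base using (Bool)
import Data.Bool.Properties as Bool
open import Data.Fin.Base using (Fin; zero; toℕ)
open import Data.Fin.Permutation as Perm using (Permutation′; _⟨$⟩ʳ_)
import Data.Fin.Properties as Fin
open import Data.List.Base using (List; []; _∷_; allFin; filter; take)
open import Data.List.Extrema using (max)
open import Data.List.Relation.Unary.All using (All)
open import Data.Nat.Base using (ℕ; suc; _*_; _≤_; _<_)
import Data.Nat.Properties as ℕ
open import Data.Product using (∃₂; ∃-syntax; ∃!; _×_; _,_)
open import Data.Vec.Base using (Vec; lookup)
open import Relation.Binary.PropositionalEquality.Core using (_≡_)
open import Relation.Nullary.Decidable.Core using (Dec; _→-dec_)

private
  variable
    n : ℕ

Query : ℕ → Set
Query n = Vec Bool n

Score : ℕ → Set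
Score n = Fin (suc n)

Secret : ℕ → Set
Secret n = Vec Bool n × Permutation′ n

infix 4 _≈_

-- Permutations carry inverse proofs, so they are compared as functions.
_≈_ : Secret n → Secret n → Set
(z , π) ≈ (z′ , π′) = z ≡ z′ × π Perm.≈ π′

-- Positions are counted from 0, so the first i positions in the order π
-- are the π j with j < i (that is, j ≤ i when counting from 1).
AgreeUpTo : Secret n → Query n → Score n → Set
AgreeUpTo (z , π) x i =
  ∀ j → toℕ j < toℕ i → lookup z (π ⟨$⟩ʳ j) ≡ lookup x (π ⟨$⟩ʳ j)

agreeUpTo? : (s : Secret n) (x : Query n) (i : Score n) → Dec (AgreeUpTo s x i)
agreeUpTo? (z , π) x i = Fin.all? λ j →
  (toℕ j ℕ.<? toℕ i) →-dec (lookup z (π ⟨$⟩ʳ j) Bool.≟ lookup x (π ⟨$⟩ʳ j))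

-- The default value zero is harmless: AgreeUpTo s x zero always holds.
score : Secret n → Query n → Score n
score {n} s x =
  max (Fin.≤-totalOrder (suc n)) zero (filter (agreeUpTo? s x) (allFin (suc n)))

History : ℕ → Set
History n = List (Query n × Score n)

Consistent : History n → Secret n → Set
Consistent h s = All (λ (x , i) → score s x ≡ i) h

Identified : History n → Set
Identified h = ∃! _≈_ (Consistent h)

data Strategy (n : ℕ) : Set where
  leaf : Strategy n
  node : Query n → (Score n → Strategy n) → Strategy n

play : Strategy n → Secret n → History n
play leaf       s = []
play (node x T) s = (x , score s x) ∷ play (T (score s x)) s

IsLeast : (ℕ → Set) → ℕ → Set
IsLeast P m = P m × (∀ {k} → P k → m ≤ k)

-- No t qualifies if a leaf is reached before the secret is identified.
-- The least t never exceeds the length of the play, since taking more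
-- entries than there are gives the whole play again.
IsComplexityOn : Strategy n → Secret n → ℕ → Set
IsComplexityOn T s = IsLeast λ t → Identified (take t (play T s))

-- The first component also demands that T identifies every secret.
IsComplexity : Strategy n → ℕ → Set
IsComplexity {n} T w =
  (∀ s → ∃[ t ] IsComplexityOn T s t × t ≤ w) × (∃[ s ] IsComplexityOn T s w)

IsQueryComplexity : ℕ → ℕ → Set
IsQueryComplexity n = IsLeast λ w → ∃[ T ] IsComplexity {n} T w

infix 4 _∈Θ_

-- c₁ plays the role of the reciprocal of the usual lower constant.
_∈Θ_ : (ℕ → ℕ) → (ℕ → ℕ) → Set
f ∈Θ g = ∃₂ λ c₁ c₂ → ∃[ n₀ ] ∀ n → n₀ ≤ n → g n ≤ c₁ * f n × f n ≤ c₂ * g n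

{-# OPTIONS --safe #-}

-- Upper bound: once π(1), …, π(k) and the values of z there are known, a query that is
-- right on these positions and equals c elsewhere has a score above k iff
-- z_{π(k+1)} = c(π(k+1)). Letting c be constant and then each binary digit of the
-- position determines z_{π(k+1)} and π(k+1) with O(log n) queries.
--
-- Lower bound: the adversary fixes z_{π(j)} to be the parity of j and reveals π two
-- positions at a time, keeping a set V from which both of the next two positions are
-- still free to come. As they need opposite values, one query cannot be right on both
-- throughout V: the adversary keeps the half of V on which the query is wrong at the
-- first of them, or the half on which it is right at the first and thus wrong at the
-- second. Every query at most halves V and reveals nothing about later positions, so
-- each of the n/2 rounds takes Ω(log n) queries while Ω(n) positions are left.
module Submission where

open import Data.Bool.Base using (Bool; true; false; not; if_then_else_)
import Data.Bool.Properties as Bool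
open import Data.Fin.Base as Fin using (Fin; zero; suc; toℕ; fromℕ<; inject₁; inject≤; finToFun; funToFin)
open import Data.Fin.Permutation as Perm using (Permutation′; _⟨$⟩ʳ_; _⟨$⟩ˡ_; inverseˡ; inverseʳ; _∘ₚ_)
import Data.Fin.Permutation.Components as PC
import Data.Fin.Properties as Fin
open import Data.Fin.Subset.Properties using (anySubset?)
open import Data.List.Base using (List; []; _∷_; length; allFin; map; filter; take; tabulate)
import Data.List.Extrema as Extrema
import Data.List.Properties as List
open import Data.List.Membership.Propositional using (_∈_)
open import Data.List.Membership.Propositional.Properties using (∈-filter⁺; ∈-filter⁻; ∈-allFin)
open import Data.List.Relation.Unary.All as All using (All; []; _∷_)
import Data.List.Relation.Unary.All.Properties as All
open import Data.List.Relation.Unary.Any using (here; there)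
open import Data.List.Relation.Unary.AllPairs using ([]; _∷_)
open import Data.List.Relation.Unary.Unique.Propositional using (Unique)
import Data.List.Relation.Unary.Unique.Propositional.Properties as Unique
open import Data.Nat.Base using (ℕ; zero; suc; _+_; _*_; _^_; _∸_; _≤_; _<_; z≤n; s≤s; ⌊_/2⌋)
open import Data.Nat.Logarithm using (⌊log₂_⌋; ⌊log₂⌋-mono-≤; ⌊log₂[2^n]⌋≡n; ⌊log₂⌊n/2⌋⌋≡⌊log₂n⌋∸1)
import Data.Nat.Properties as ℕ
open import Data.Nat.Tactic.RingSolver using (solve-∀)
open import Data.Product using (∃; ∃-syntax; _×_; _,_; proj₁; proj₂)
open import Data.Sum.Base using (_⊎_; inj₁; inj₂)
open import Data.Vec.Base as Vec using (lookup; replicate)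
import Data.Vec.Properties as Vec
open import Function.Base using (_∘_; id; case_of_)
open import Function.Bundles using (_⇔_; mk⇔; module Equivalence; module Injection; module Inverse)
open import Function.Construct.Composition using (_⇔-∘_)
open import Function.Construct.Symmetry using (⇔-sym)
open import Function.Properties.Inverse using (↔⇒↣)
open import Relation.Binary.Definitions using (_Respects_)
open import Relation.Binary.PropositionalEquality
open import Relation.Nullary using (¬_; Dec; yes; no; contradiction)
open import Relation.Nullary.Decidable using (does; dec-true; dec-false; map′; ¬?; decidable-stable; _×-dec_; _→-dec_)
open import Relation.Unary using (Decidable; Pred)
open import Defs

private
  variable
    n : ℕ

-- Least numbers and equality of secrets.

least : ∀ {P : ℕ → Set} → Decidable P → ∀ m → P m → ∃[ k ] IsLeast P k × k ≤ m
least P? m pm with P? 0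
least P? m pm | yes p₀ = 0 , (p₀ , λ _ → z≤n) , z≤n
least P? zero pm | no ¬p₀ = contradiction pm ¬p₀
least P? (suc m) pm | no ¬p₀ with least (P? ∘ suc) m pm
... | k , (pk , min) , k≤m =
  suc k , (pk , λ { {zero} p₀ → contradiction p₀ ¬p₀ ; {suc j} pj → s≤s (min pj) }) , s≤s k≤m

take-All-≤ : ∀ {ℓ} {A : Set} {P : Pred A ℓ} {k m} (xs : List A) → k ≤ m →
             All P (take m xs) → All P (take k xs)
take-All-≤ xs z≤n pxs = []
take-All-≤ [] (s≤s k≤m) pxs = []
take-All-≤ (x ∷ xs) (s≤s k≤m) (px ∷ pxs) = px ∷ take-All-≤ xs k≤m pxs

≈-sym : ∀ (s s′ : Secret n) → s ≈ s′ → s′ ≈ s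
≈-sym _ _ (refl , eq) = refl , sym ∘ eq

≈-trans : ∀ (s s′ s″ : Secret n) → s ≈ s′ → s′ ≈ s″ → s ≈ s″
≈-trans _ _ _ (refl , eq₁) (refl , eq₂) = refl , λ i → trans (eq₁ i) (eq₂ i)

_≈?_ : (s s′ : Secret n) → Dec (s ≈ s′)
(z , π) ≈? (z′ , π′) =
  Vec.≡-dec Bool._≟_ z z′ ×-dec Fin.all? λ i → (π ⟨$⟩ʳ i) Fin.≟ (π′ ⟨$⟩ʳ i)

⟨$⟩ʳ-injective : ∀ (π : Permutation′ n) {i j} → π ⟨$⟩ʳ i ≡ π ⟨$⟩ʳ j → i ≡ j
⟨$⟩ʳ-injective π = Injection.injective (↔⇒↣ π)

-- Scores and the first mismatch.

Matches : Secret n → Query n → Fin n → Set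
Matches (z , π) x j = lookup z (π ⟨$⟩ʳ j) ≡ lookup x (π ⟨$⟩ʳ j)

agreeUpTo⇒≤score : ∀ (s : Secret n) x {i} → AgreeUpTo s x i → toℕ i ≤ toℕ (score s x)
agreeUpTo⇒≤score s x {i} agree =
  All.lookup (Extrema.xs≤max (Fin.≤-totalOrder _) zero _)
    (∈-filter⁺ (agreeUpTo? s x) (∈-allFin i) agree)

agreeUpTo-score : ∀ (s : Secret n) x → AgreeUpTo s x (score s x)
agreeUpTo-score s x =
  Extrema.argmax-all (Fin.≤-totalOrder _) id {P = AgreeUpTo s x} {zero} {filter (agreeUpTo? s x) (allFin _)}
    (λ _ ()) (All.all-filter (agreeUpTo? s x) (allFin _))

agreeUpTo-cong : ∀ (s s′ : Secret n) x {i} → s ≈ s′ → AgreeUpTo s x i → AgreeUpTo s′ x i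
agreeUpTo-cong (z , _) _ x (refl , π≈) agree j j<i =
  subst (λ p → lookup z p ≡ lookup x p) (π≈ j) (agree j j<i)

score-cong : ∀ {s s′ : Secret n} x → s ≈ s′ → score s x ≡ score s′ x
score-cong {s = s} {s′} x s≈s′ = Fin.≤-antisym
  (agreeUpTo⇒≤score s′ x (agreeUpTo-cong s s′ x s≈s′ (agreeUpTo-score s x)))
  (agreeUpTo⇒≤score s x (agreeUpTo-cong s′ s x (≈-sym s s′ s≈s′) (agreeUpTo-score s′ x)))

-- Taking `i = suc k` in `AgreeUpTo`: a match at k is exactly what extends agreement from k to k + 1
-- positions. This is the one bit that the upper bound draws from a query.
matches⇔<score : ∀ (s : Secret n) x k → (∀ j → toℕ j < toℕ k → Matches s x j) →
                 Matches s x k ⇔ toℕ k < toℕ (score s x)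
matches⇔<score s x k before = mk⇔
  (λ match → agreeUpTo⇒≤score s x λ j j<1+k → case ℕ.m≤n⇒m<n∨m≡n (ℕ.≤-pred j<1+k) of λ where
    (inj₁ j<k) → before j j<k
    (inj₂ j≡k) → subst (Matches s x) (sym (Fin.toℕ-injective j≡k)) match)
  (agreeUpTo-score s x k)

-- Agreement before k excludes smaller scores, the mismatch at k excludes larger ones. Every answer
-- of the adversary comes from this.
score-firstMismatch : ∀ (s : Secret n) x k → (∀ j → toℕ j < toℕ k → Matches s x j) →
                      ¬ Matches s x k → score s x ≡ inject₁ k
score-firstMismatch s x k before mismatch = Fin.toℕ-injective (trans
  (ℕ.≤-antisym
    (ℕ.≮⇒≥ (mismatch ∘ Equivalence.from (matches⇔<score s x k before)))
    (subst (_≤ toℕ (score s x)) (Fin.toℕ-inject₁ k)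
      (agreeUpTo⇒≤score s x λ j j<k → before j (subst (toℕ j <_) (Fin.toℕ-inject₁ k) j<k))))
  (sym (Fin.toℕ-inject₁ k)))

-- Finite search over permutations and secrets.

consistent-resp : ∀ (h : History n) → Consistent h Respects _≈_
consistent-resp h {s} {s′} s≈s′ =
  All.map λ {(x , _)} eq → trans (sym (score-cong {s = s} {s′} x s≈s′)) eq

consistent? : ∀ (h : History n) → Decidable (Consistent h)
consistent? h s = All.all? (λ (x , i) → score s x Fin.≟ i) h

insert-cong : ∀ {i j} {π ρ : Permutation′ n} → π Perm.≈ ρ →
              Perm.insert i j π Perm.≈ Perm.insert i j ρ
insert-cong {i = i} {j} π≈ρ k with i Fin.≟ k
... | yes _ = refl
... | no i≢k = cong (Fin.punchIn j) (π≈ρ (Fin.punchOut i≢k))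

-- Recursion on the image j of `zero`; what is left is a permutation of one point fewer. Inserting j
-- again recovers π only pointwise, hence the hypothesis that P respects `Perm.≈`.
anyPermutation? : ∀ {P : Permutation′ n → Set} → P Respects Perm._≈_ → Decidable P → Dec (∃ P)
anyPermutation? {zero} resp P? = map′ (Perm.id ,_) (λ (π , p) → resp (λ ()) p) (P? Perm.id)
anyPermutation? {suc n} {P} resp P? = map′
  (λ (j , π , p) → Perm.insert zero j π , p)
  (λ (π , p) → π ⟨$⟩ʳ zero , Perm.remove zero π , resp (sym ∘ Perm.insert-remove zero π) p)
  (Fin.any? λ j → anyPermutation? {P = P ∘ Perm.insert zero j}
    (λ {π} {ρ} π≈ρ → resp (insert-cong {i = zero} {j} {π = π} {ρ} π≈ρ)) (P? ∘ Perm.insert zero j))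

anySecret? : ∀ {P : Secret n → Set} → P Respects _≈_ → Decidable P → Dec (∃ P)
anySecret? resp P? = map′
  (λ (z , π , p) → (z , π) , p) (λ ((z , π) , p) → z , π , p)
  -- Subsets are Boolean vectors, so `anySubset?` searches all z.
  (anySubset? λ z → anyPermutation? (λ π≈ → resp (refl , π≈)) (λ π → P? (z , π)))

allSecrets? : ∀ {P : Secret n → Set} → P Respects _≈_ → Decidable P → Dec (∀ s → P s)
allSecrets? resp P? = map′
  (λ ¬∃ s → decidable-stable (P? s) (λ ¬p → ¬∃ (s , ¬p)))
  (λ all (s , ¬p) → ¬p (all s))
  (¬? (anySecret? (λ {s} {s′} eq ¬p p → ¬p (resp (≈-sym s s′ eq) p)) (¬? ∘ P?)))

-- Solvability as a decidable game, and its equivalence with strategies.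

-- Unlike `Identified`, this also holds if no secret is consistent, as happens after scores that
-- cannot occur.
AtMostOne : History n → Set
AtMostOne h = ∀ s s′ → Consistent h s → Consistent h s′ → s ≈ s′

atMostOne? : (h : History n) → Dec (AtMostOne h)
atMostOne? h = allSecrets?
  (λ {s} {t} s≈t f s′ ct cs′ → ≈-trans t s s′ (≈-sym s t s≈t)
    (f s′ (consistent-resp h {t} {s} (≈-sym s t s≈t) ct) cs′))
  λ s → allSecrets?
    (λ {s′} {t} s′≈t f cs ct → ≈-trans s s′ t
      (f cs (consistent-resp h {t} {s′} (≈-sym s′ t s′≈t) ct)) s′≈t)
    λ s′ → consistent? h s →-dec consistent? h s′ →-dec s ≈? s′

-- The value of the game without trees: strategies of unbounded depth cannot be searched, but this
-- recursion on the number of remaining queries can.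
Solvable : ℕ → History n → Set
Solvable zero h = AtMostOne h
Solvable (suc w) h = ∃[ x ] ∀ i → Solvable w ((x , i) ∷ h)

-- For fixed w the search is finite. Its decidability is what yields a least w, and thereby the
-- query complexity as a function of n.
solvable? : ∀ w (h : History n) → Dec (Solvable w h)
solvable? zero h = atMostOne? h
solvable? (suc w) h = anySubset? λ x → Fin.all? λ i → solvable? w ((x , i) ∷ h)

Separates : ℕ → Strategy n → History n → Set
Separates w T h = ∀ s s′ → Consistent h s → Consistent h s′ →
                  Consistent (take w (play T s)) s′ → s ≈ s′

solvable⇒separates : ∀ w (h : History n) → Solvable w h → ∃[ T ] Separates w T h
solvable⇒separates zero h sol = leaf , λ s s′ c c′ _ → sol s s′ c c′
solvable⇒separates (suc w) h (x , sol) =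
  node x (λ i → proj₁ (next i)) ,
  λ { s s′ c c′ (eq ∷ rest) → proj₂ (next (score s x)) s s′ (refl ∷ c) (eq ∷ c′) rest }
  where
  next : ∀ i → ∃[ T ] Separates w T ((x , i) ∷ h)
  next i = solvable⇒separates w ((x , i) ∷ h) (sol i)

separates⇒solvable : ∀ w (T : Strategy n) h → Separates w T h → Solvable w h
separates⇒solvable zero T h sep s s′ c c′ = sep s s′ c c′ []
-- A strategy that has ended may be padded with any query: further answers only shrink the set of
-- consistent secrets.
separates⇒solvable {n} (suc w) leaf h sep = replicate n false , λ i →
  separates⇒solvable w leaf _ λ { s s′ (_ ∷ c) (_ ∷ c′) _ → sep s s′ c c′ [] }
separates⇒solvable (suc w) (node x T) h sep = x , λ i →
  separates⇒solvable w (T i) _ λ { s s′ (eq ∷ c) (eq′ ∷ c′) rest →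
    sep s s′ c c′ (trans eq′ (sym eq) ∷
      subst (λ j → Consistent (take w (play (T j) s)) s′) (sym eq) rest) }

play-cong : ∀ (T : Strategy n) {s s′} → s ≈ s′ → play T s ≡ play T s′
play-cong leaf s≈s′ = refl
play-cong (node x T) {s} {s′} s≈s′ rewrite score-cong {s = s} {s′} x s≈s′ =
  cong ((x , score s′ x) ∷_) (play-cong (T (score s′ x)) {s} {s′} s≈s′)

play-consistent : ∀ t (T : Strategy n) s → Consistent (take t (play T s)) s
play-consistent zero T s = []
play-consistent (suc t) leaf s = []
play-consistent (suc t) (node x T) s = refl ∷ play-consistent t (T (score s x)) s

IdentifiedWithin : Strategy n → Secret n → ℕ → Set
IdentifiedWithin T s t = Identified (take t (play T s))

identified⇒≈ : ∀ (T : Strategy n) s t → IdentifiedWithin T s t →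
               ∀ s′ → Consistent (take t (play T s)) s′ → s ≈ s′
identified⇒≈ T s t (r , _ , unique) s′ c′ =
  ≈-trans s r s′ (≈-sym r s (unique {s} (play-consistent t T s))) (unique {s′} c′)

identified⇔atMostOne : ∀ (T : Strategy n) s t →
                       IdentifiedWithin T s t ⇔ AtMostOne (take t (play T s))
identified⇔atMostOne T s t = mk⇔
  (λ (r , _ , unique) s₁ s₂ c₁ c₂ →
    ≈-trans s₁ r s₂ (≈-sym r s₁ (unique {s₁} c₁)) (unique {s₂} c₂))
  (λ only → s , play-consistent t T s , λ {s′} c′ → only s s′ (play-consistent t T s) c′)

identified? : ∀ (T : Strategy n) s → Decidable (IdentifiedWithin T s)
identified? T s t = map′ (Equivalence.from eqv) (Equivalence.to eqv) (atMostOne? _)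
  where eqv = identified⇔atMostOne T s t

identified-mono : ∀ (T : Strategy n) s {t u} → t ≤ u →
                  IdentifiedWithin T s t → IdentifiedWithin T s u
identified-mono T s {t} {u} t≤u ident =
  s , play-consistent u T s ,
  λ {s′} c′ → identified⇒≈ T s t ident s′ (take-All-≤ (play T s) t≤u c′)

-- The strategy obtained from `Solvable w` attains w on some secret: if w - 1 queries sufficed for
-- all secrets, the game would be solvable with w - 1. Conversely, a strategy of complexity k makes
-- the game solvable with k, so w ≤ k.
leastSolvable⇒queryComplexity : ∀ {w} → IsLeast (λ w → Solvable {n} w []) w →
                                IsQueryComplexity n w
leastSolvable⇒queryComplexity {n} {w} (sol , minimal) =
  (T , (λ s → least (identified? T s) w (identifies s)) , worst w minimal identifies) ,
  λ {k} (T′ , each , _) → minimal (separates⇒solvable k T′ [] λ s s′ _ _ c′ →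
    let (t , (ident , _) , t≤k) = each s in
    identified⇒≈ T′ s k (identified-mono T′ s t≤k ident) s′ c′)
  where
  T : Strategy n
  T = proj₁ (solvable⇒separates w [] sol)

  identifies : ∀ s → IdentifiedWithin T s w
  identifies s = s , play-consistent w T s ,
    λ {s′} → proj₂ (solvable⇒separates w [] sol) s s′ [] []

  worst : ∀ w → (∀ {k} → Solvable {n} k [] → w ≤ k) →
          (∀ s → IdentifiedWithin T s w) → ∃[ s ] IsComplexityOn T s w
  worst zero minimal identifies = s₀ , identifies s₀ , λ _ → z≤n
    where s₀ = replicate n false , Perm.id
  worst (suc w) minimal identifies
    with anySecret? {P = λ s → ¬ IdentifiedWithin T s w}
           (λ {s} {s′} s≈s′ → subst (λ p → ¬ Identified (take w p)) (play-cong T {s} {s′} s≈s′))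
           (λ s → ¬? (identified? T s w))
  ... | yes (s , late) = s , identifies s ,
        λ {k} ident → ℕ.≰⇒> λ k≤w → late (identified-mono T s k≤w ident)
  ... | no ¬late = contradiction
        (minimal (separates⇒solvable w T [] λ s s′ _ _ c′ →
          identified⇒≈ T s w
            (decidable-stable (identified? T s w) (λ late → ¬late (s , late))) s′ c′))
        ℕ.1+n≰n

-- Upper bound: probing for the next position.

Prefix : ℕ → Secret n → Secret n → Set
Prefix k (z , π) (z′ , π′) = ∀ j → toℕ j < k →
  π ⟨$⟩ʳ j ≡ π′ ⟨$⟩ʳ j × lookup z (π ⟨$⟩ʳ j) ≡ lookup z′ (π′ ⟨$⟩ʳ j)

PrefixKnown : ℕ → History n → Set
PrefixKnown k h = ∀ s s′ → Consistent h s → Consistent h s′ → Prefix k s s′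

-- Only the first k positions of the given secret and its values there matter, so any consistent
-- secret can stand in for the hidden one once the prefix is known.
probe : Secret n → ℕ → (Fin n → Bool) → Query n
probe (z , π) k c =
  Vec.tabulate λ p → if does (toℕ (π ⟨$⟩ˡ p) ℕ.<? k) then lookup z p else c p

module _ (s₀ s : Secret n) (k : Fin n) (c : Fin n → Bool) (same : Prefix (toℕ k) s₀ s) where
  private
    z₀ = proj₁ s₀
    π₀ = proj₂ s₀
    z = proj₁ s
    π = proj₂ s

  probe-before : ∀ j → toℕ j < toℕ k → Matches s (probe s₀ (toℕ k) c) j
  probe-before j j<k with same j j<k
  ... | π₀j≡πj , z₀≡z = begin
    lookup z (π ⟨$⟩ʳ j)    ≡⟨ z₀≡z ⟨
    lookup z₀ (π₀ ⟨$⟩ʳ j)  ≡⟨ cong (if_then lookup z₀ (π₀ ⟨$⟩ʳ j) else c (π₀ ⟨$⟩ʳ j))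
                                (dec-true (_ ℕ.<? _)
                                  (subst (λ i → toℕ i < toℕ k) (sym (inverseˡ π₀)) j<k)) ⟨
    _                      ≡⟨ Vec.lookup∘tabulate _ (π₀ ⟨$⟩ʳ j) ⟨
    lookup x (π₀ ⟨$⟩ʳ j)   ≡⟨ cong (lookup x) π₀j≡πj ⟩
    lookup x (π ⟨$⟩ʳ j)    ∎
    where
    open ≡-Reasoning
    x = probe s₀ (toℕ k) c

  probe-here : lookup (probe s₀ (toℕ k) c) (π ⟨$⟩ʳ k) ≡ c (π ⟨$⟩ʳ k)
  probe-here = trans (Vec.lookup∘tabulate _ (π ⟨$⟩ʳ k))
    (cong (if_then lookup z₀ (π ⟨$⟩ʳ k) else c (π ⟨$⟩ʳ k)) (dec-false (_ ℕ.<? _) unknown))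
    where
    m = π₀ ⟨$⟩ˡ (π ⟨$⟩ʳ k)

    -- If m < k, the shared prefix gives π(m) = π₀(m) = π(k), so m = k by injectivity.
    unknown : ¬ toℕ m < toℕ k
    unknown m<k = ℕ.<⇒≢ m<k (cong toℕ (⟨$⟩ʳ-injective π
      (trans (sym (proj₁ (same m m<k))) (inverseʳ π₀))))

  probe-score : lookup z (π ⟨$⟩ʳ k) ≡ c (π ⟨$⟩ʳ k) ⇔ toℕ k < toℕ (score s (probe s₀ (toℕ k) c))
  probe-score = mk⇔
    (λ z≡c → Equivalence.to passes (trans z≡c (sym probe-here)))
    (λ k< → trans (Equivalence.from passes k<) probe-here)
    where passes = matches⇔<score s (probe s₀ (toℕ k) c) k probe-before

-- Two Booleans that both differ from a third are equal.
≡-cancel : ∀ {a b a′ b′ : Bool} → a ≡ a′ → (a ≡ b ⇔ a′ ≡ b′) → b ≡ b′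
≡-cancel {a} {b} {b′ = b′} refl eqv with a Bool.≟ b | a Bool.≟ b′
... | yes a≡b | yes a≡b′ = trans (sym a≡b) a≡b′
... | yes a≡b | no a≢b′ = contradiction (Equivalence.to eqv a≡b) a≢b′
... | no a≢b | yes a≡b′ = contradiction (Equivalence.from eqv a≡b′) a≢b
... | no a≢b | no a≢b′ = trans (Bool.¬-not (a≢b ∘ sym)) (sym (Bool.¬-not (a≢b′ ∘ sym)))

funToFin-cong : ∀ {m n} {f g : Fin m → Fin n} → f ≗ g → funToFin f ≡ funToFin g
funToFin-cong {zero} f≗g = refl
funToFin-cong {suc m} f≗g = cong₂ Fin.combine (f≗g zero) (funToFin-cong (f≗g ∘ suc))

module _ {n} L (n≤2^L : n ≤ 2 ^ L) where

  -- `finToFun` reads an element of `Fin (2 ^ L)` as its L binary digits.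
  bit : Fin L → Fin n → Bool
  bit b p = Inverse.to Fin.2↔Bool (finToFun {2} {L} (inject≤ p n≤2^L) b)

  bits-injective : ∀ {p q} → (∀ b → bit b p ≡ bit b q) → p ≡ q
  bits-injective {p} {q} same = Fin.inject≤-injective n≤2^L n≤2^L p q (begin
    inject≤ p n≤2^L                           ≡⟨ Fin.funToFin-finToFin {L} {2} _ ⟨
    funToFin (finToFun {2} {L} (inject≤ p n≤2^L)) ≡⟨ funToFin-cong
                                                 (λ b → Injection.injective (↔⇒↣ Fin.2↔Bool) (same b)) ⟩
    funToFin (finToFun {2} {L} (inject≤ q n≤2^L)) ≡⟨ Fin.funToFin-finToFin {L} {2} _ ⟩
    inject≤ q n≤2^L                           ∎)
    where open ≡-Reasoning

  -- The constant colouring reveals the bit z_{π(k)}; given it, each further answer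
  -- reveals one binary digit of π(k).
  colourings : List (Fin n → Bool)
  colourings = (λ _ → false) ∷ tabulate bit

  probes : Secret n → ℕ → List (Query n)
  probes s k = map (probe s k) colourings

  length-probes : ∀ s k → length (probes s k) ≡ suc L
  length-probes s k = trans (List.length-map (probe s k) colourings)
    (cong suc (List.length-tabulate bit))

  probes-determine : ∀ (s₀ s s′ : Secret n) k → Prefix (toℕ k) s₀ s → Prefix (toℕ k) s₀ s′ →
    All (λ x → score s x ≡ score s′ x) (probes s₀ (toℕ k)) →
    proj₂ s ⟨$⟩ʳ k ≡ proj₂ s′ ⟨$⟩ʳ k ×
    lookup (proj₁ s) (proj₂ s ⟨$⟩ʳ k) ≡ lookup (proj₁ s′) (proj₂ s′ ⟨$⟩ʳ k)
  probes-determine s₀ s s′ k pre pre′ (same₀ ∷ sames) = bits-injective sameBit , sameValue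
    where
    transfer : ∀ c → score s (probe s₀ (toℕ k) c) ≡ score s′ (probe s₀ (toℕ k) c) →
               lookup (proj₁ s) (proj₂ s ⟨$⟩ʳ k) ≡ c (proj₂ s ⟨$⟩ʳ k) ⇔
               lookup (proj₁ s′) (proj₂ s′ ⟨$⟩ʳ k) ≡ c (proj₂ s′ ⟨$⟩ʳ k)
    transfer c same =
      ⇔-sym (probe-score s₀ s′ k c pre′) ⇔-∘
      subst (λ i → _ ⇔ toℕ k < toℕ i) same (probe-score s₀ s k c pre)

    sameValue : lookup (proj₁ s) (proj₂ s ⟨$⟩ʳ k) ≡ lookup (proj₁ s′) (proj₂ s′ ⟨$⟩ʳ k)
    -- The equations are flipped so that the constant colour `false` is the common left-hand side.
    sameValue = ≡-cancel refl (mk⇔ sym sym ⇔-∘ (transfer _ same₀ ⇔-∘ mk⇔ sym sym))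

    sameBit : ∀ b → bit b (proj₂ s ⟨$⟩ʳ k) ≡ bit b (proj₂ s′ ⟨$⟩ʳ k)
    sameBit b = ≡-cancel sameValue
      (transfer (bit b) (All.tabulate⁻ (All.map⁻ sames) b))

-- Asks a fixed block of queries. The continuation need not know the answers, only that all secrets
-- still consistent give the same ones.
solvable-all : ∀ w (xs : List (Query n)) {h} →
  (∀ h′ → (∀ s → Consistent h′ s → Consistent h s) →
    (∀ s s′ → Consistent h′ s → Consistent h′ s′ → All (λ x → score s x ≡ score s′ x) xs) →
    Solvable w h′) →
  Solvable (length xs + w) h
solvable-all w [] {h} sol = sol h (λ _ → id) (λ _ _ _ _ → [])
solvable-all w (x ∷ xs) sol = x , λ i → solvable-all w xs λ h′ sub same →
  sol h′ (λ s → All.tail ∘ sub s) λ s s′ c c′ →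
    trans (All.head (sub s c)) (sym (All.head (sub s′ c′))) ∷ same s s′ c c′

atMostOne⇒solvable : ∀ w (h : History n) → AtMostOne h → Solvable w h
atMostOne⇒solvable w h only = separates⇒solvable w leaf h λ s s′ c c′ _ → only s s′ c c′

-- Induction on the number m of unknown positions: a block of 1 + L probes settles the next position
-- and its value.
solvable-from : ∀ {n} L → n ≤ 2 ^ L → ∀ m k → k + m ≡ n → (h : History n) →
                PrefixKnown k h → Solvable (m * suc L) h
solvable-from {n} L n≤2^L zero k k+0≡n h known (z , π) (z′ , π′) c c′ =
  trans (sym (Vec.tabulate∘lookup z)) (trans (Vec.tabulate-cong z≗z′) (Vec.tabulate∘lookup z′)) ,
  proj₁ ∘ full
  where
  full : ∀ j → π ⟨$⟩ʳ j ≡ π′ ⟨$⟩ʳ j × lookup z (π ⟨$⟩ʳ j) ≡ lookup z′ (π′ ⟨$⟩ʳ j)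
  full j = known (z , π) (z′ , π′) c c′ j
    (subst (toℕ j <_) (trans (sym k+0≡n) (ℕ.+-identityʳ k)) (Fin.toℕ<n j))

  z≗z′ : ∀ p → lookup z p ≡ lookup z′ p
  z≗z′ p with full (π ⟨$⟩ˡ p)
  ... | π≡ , z≡ = subst (λ q → lookup z q ≡ lookup z′ q) (inverseʳ π)
    (trans z≡ (cong (lookup z′) (sym π≡)))
solvable-from {n} L n≤2^L (suc m) k k+1+m≡n h known
  with anySecret? (λ {s} {s′} → consistent-resp h {s} {s′}) (consistent? h)
... | no ¬∃ = atMostOne⇒solvable (suc m * suc L) h λ s _ c _ → contradiction (s , c) ¬∃
-- The probes are built from `s₀`, which need not be the hidden secret but shares its known prefix.
... | yes (s₀ , c₀) = subst (λ l → Solvable (l + m * suc L) h) (length-probes L n≤2^L s₀ (toℕ K))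
  (solvable-all (m * suc L) (probes L n≤2^L s₀ (toℕ K)) λ h′ sub same →
    solvable-from L n≤2^L m (suc k) (trans (sym (ℕ.+-suc k m)) k+1+m≡n) h′
      λ s s′ c c′ j j<1+k → case ℕ.m≤n⇒m<n∨m≡n (ℕ.≤-pred j<1+k) of λ where
        (inj₁ j<k) → known s s′ (sub s c) (sub s′ c′) j j<k
        (inj₂ j≡k) → subst
          (λ i → proj₂ s ⟨$⟩ʳ i ≡ proj₂ s′ ⟨$⟩ʳ i ×
                 lookup (proj₁ s) (proj₂ s ⟨$⟩ʳ i) ≡ lookup (proj₁ s′) (proj₂ s′ ⟨$⟩ʳ i))
          (Fin.toℕ-injective (trans K≡k (sym j≡k)))
          (probes-determine L n≤2^L s₀ s s′ K
            (prefix s (sub s c)) (prefix s′ (sub s′ c′)) (same s s′ c c′)))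
  where
  k<n : k < n
  k<n = subst (k <_) k+1+m≡n (ℕ.m<m+n k (s≤s z≤n))

  K : Fin n
  K = fromℕ< k<n

  K≡k : toℕ K ≡ k
  K≡k = Fin.toℕ-fromℕ< k<n

  prefix : ∀ s → Consistent h s → Prefix (toℕ K) s₀ s
  prefix s c = subst (λ i → Prefix i s₀ s) (sym K≡k) (known s₀ s c₀ c)

-- Lower bound: pigeonhole and placing elements in a permutation.

firstFailure : ∀ {P : Fin n → Set} → Decidable P → ¬ (∀ j → P j) →
               ∃[ k ] ¬ P k × ∀ j → toℕ j < toℕ k → P j
firstFailure {P = P} P? ¬all with Fin.¬∀⟶∃¬-smallest _ P P? ¬all
... | k , ¬pk , before = k , ¬pk , λ j j<k → subst P
  (Fin.toℕ-injective (trans (Fin.toℕ-inject (fromℕ< j<k)) (Fin.toℕ-fromℕ< j<k)))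
  (before (fromℕ< j<k))

length-filter-split : ∀ {A : Set} {P : A → Set} (P? : Decidable P) xs →
                      length (filter P? xs) + length (filter (¬? ∘ P?) xs) ≡ length xs
length-filter-split P? [] = refl
length-filter-split P? (x ∷ xs) with does (P? x)
... | true = cong suc (length-filter-split P? xs)
... | false = trans (ℕ.+-suc _ _) (cong suc (length-filter-split P? xs))

m+m≤p+q⇒m≤p⊎m≤q : ∀ m p q → m + m ≤ p + q → m ≤ p ⊎ m ≤ q
m+m≤p+q⇒m≤p⊎m≤q m p q m+m≤p+q with m ℕ.≤? p | m ℕ.≤? q
... | yes m≤p | _ = inj₁ m≤p
... | no _ | yes m≤q = inj₂ m≤q
... | no m≰p | no m≰q =
  contradiction m+m≤p+q (ℕ.<⇒≱ (ℕ.+-mono-< (ℕ.≰⇒> m≰p) (ℕ.≰⇒> m≰q)))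

distinctPair : ∀ {A : Set} {V : List A} → Unique V → 2 ≤ length V →
               ∃[ p ] ∃[ q ] p ∈ V × q ∈ V × p ≢ q
distinctPair ((p≢q ∷ _) ∷ _) (s≤s (s≤s z≤n)) = _ , _ , here refl , there (here refl) , p≢q

AgreeBelow : ℕ → Permutation′ n → Permutation′ n → Set
AgreeBelow i ρ π = ∀ j → toℕ j < i → π ⟨$⟩ʳ j ≡ ρ ⟨$⟩ʳ j

FreshFor : ℕ → Permutation′ n → Fin n → Set
FreshFor i ρ p = ∀ j → toℕ j < i → ρ ⟨$⟩ʳ j ≢ p

-- Positions a and c = ρ⁻¹(p) are swapped. As p is fresh, c does not lie before a, so the earlier
-- positions stay fixed.
place : ∀ (ρ : Permutation′ n) a p → FreshFor (toℕ a) ρ p →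
        ∃[ π ] AgreeBelow (toℕ a) ρ π × π ⟨$⟩ʳ a ≡ p
place ρ a p fresh = Perm.transpose a c ∘ₚ ρ , below , at
  where
  c = ρ ⟨$⟩ˡ p

  below : ∀ j → toℕ j < toℕ a → ρ ⟨$⟩ʳ PC.transpose a c j ≡ ρ ⟨$⟩ʳ j
  below j j<a
    rewrite dec-false (j Fin.≟ a) (ℕ.<⇒≢ j<a ∘ cong toℕ)
          | dec-false (j Fin.≟ c) (λ j≡c → fresh j j<a (trans (cong (ρ ⟨$⟩ʳ_) j≡c) (inverseʳ ρ)))
    = refl

  at : ρ ⟨$⟩ʳ PC.transpose a c a ≡ p
  at rewrite dec-true (a Fin.≟ a) refl = inverseʳ ρ

placeTwo : ∀ (ρ : Permutation′ n) a b p q → toℕ b ≡ suc (toℕ a) → p ≢ q →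
           FreshFor (toℕ a) ρ p → FreshFor (toℕ a) ρ q →
           ∃[ π ] AgreeBelow (toℕ a) ρ π × π ⟨$⟩ʳ a ≡ p × π ⟨$⟩ʳ b ≡ q
placeTwo {n} ρ a b p q b≡1+a p≢q p-fresh q-fresh with place ρ a p p-fresh
... | π , π-below , πa≡p with place π b q q-fresh′
  where
  q-fresh′ : FreshFor (toℕ b) π q
  q-fresh′ j j<b πj≡q with ℕ.m≤n⇒m<n∨m≡n (ℕ.≤-pred (subst (toℕ j <_) b≡1+a j<b))
  ... | inj₁ j<a = q-fresh j j<a (trans (sym (π-below j j<a)) πj≡q)
  ... | inj₂ j≡a = p≢q (trans (sym πa≡p)
    (trans (cong (π ⟨$⟩ʳ_) (sym (Fin.toℕ-injective j≡a))) πj≡q))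
... | σ , σ-below , σb≡q =
  σ ,
  (λ j j<a → trans (σ-below j (ℕ.<-trans j<a a<b)) (π-below j j<a)) ,
  trans (σ-below a a<b) πa≡p ,
  σb≡q
  where
  a<b : toℕ a < toℕ b
  a<b = ℕ.≤-reflexive (sym b≡1+a)

-- Lower bound: alternating secrets and the phases of the adversary.

alternate : ℕ → Bool
alternate zero = false
alternate (suc i) = not (alternate i)

zigzag : Permutation′ n → Secret n
zigzag π = Vec.tabulate (λ p → alternate (toℕ (π ⟨$⟩ˡ p))) , π

zigzag-matches : ∀ (π : Permutation′ n) x j →
                 alternate (toℕ j) ≡ lookup x (π ⟨$⟩ʳ j) ⇔ Matches (zigzag π) x j
zigzag-matches π x j = mk⇔ (trans value) (trans (sym value))
  where
  value : lookup (proj₁ (zigzag π)) (π ⟨$⟩ʳ j) ≡ alternate (toℕ j)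
  value = trans (Vec.lookup∘tabulate _ (π ⟨$⟩ʳ j)) (cong (alternate ∘ toℕ) (inverseˡ π))

score-zigzag : ∀ (π : Permutation′ n) x k →
               (∀ j → toℕ j < toℕ k → alternate (toℕ j) ≡ lookup x (π ⟨$⟩ʳ j)) →
               alternate (toℕ k) ≢ lookup x (π ⟨$⟩ʳ k) → score (zigzag π) x ≡ inject₁ k
score-zigzag π x k before mismatch = score-firstMismatch (zigzag π) x k
  (λ j j<k → Equivalence.to (zigzag-matches π x j) (before j j<k))
  (mismatch ∘ Equivalence.from (zigzag-matches π x k))

Candidate : ℕ → Permutation′ n → List (Fin n) → Permutation′ n → Set
Candidate i ρ V π =
  AgreeBelow i ρ π × (∀ j → i ≤ toℕ j → toℕ j < 2 + i → π ⟨$⟩ʳ j ∈ V)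

-- The adversary has revealed the first i positions ρ(0), …, ρ(i - 1), and lets the
-- next two positions be any two distinct elements of V.
record Phase (h : History n) (i : ℕ) (ρ : Permutation′ n) (V : List (Fin n)) : Set where
  field
    distinct : Unique V
    fresh : All (FreshFor i ρ) V
    consistent : ∀ π → Candidate i ρ V π → Consistent h (zigzag π)

-- V consists of ρ(i), ..., ρ(i + r - 1), distinct and fresh by injectivity. A phase can start here
-- because the history depends on the first i positions only.
newPhase : ∀ {h : History n} {i ρ} r → i + r ≤ n →
           (∀ π → AgreeBelow i ρ π → Consistent h (zigzag π)) →
           ∃[ V ] Phase h i ρ V × length V ≡ r
newPhase {n} {i = i} {ρ} r i+r≤n consistent =
  tabulate (λ j → ρ ⟨$⟩ʳ shift j) , phase , List.length-tabulate _
  where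
  bound : ∀ (j : Fin r) → i + toℕ j < n
  bound j = ℕ.<-≤-trans (ℕ.+-monoʳ-< i (Fin.toℕ<n j)) i+r≤n

  shift : Fin r → Fin n
  shift j = fromℕ< (bound j)

  toℕ-shift : ∀ j → toℕ (shift j) ≡ i + toℕ j
  toℕ-shift j = Fin.toℕ-fromℕ< (bound j)

  phase : Phase _ i ρ _
  phase = record
    { distinct = Unique.tabulate⁺ λ {j} {k} eq → Fin.toℕ-injective (ℕ.+-cancelˡ-≡ i _ _
        (trans (sym (toℕ-shift j)) (trans (cong toℕ (⟨$⟩ʳ-injective ρ eq)) (toℕ-shift k))))
    ; fresh = All.tabulate⁺ λ j k k<i eq → ℕ.<⇒≱ k<i
        (subst (i ≤_) (trans (sym (toℕ-shift j)) (cong toℕ (sym (⟨$⟩ʳ-injective ρ eq))))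
          (ℕ.m≤m+n i (toℕ j)))
    ; consistent = λ π (below , _) → consistent π below
    }

module _ {h : History n} {i ρ V} (phase : Phase h i ρ V) where
  open Phase phase

  -- Shrinking V only removes candidates, so earlier answers stay valid and just the new one has to
  -- be checked.
  refine : ∀ {P : Fin n → Set} (P? : Decidable P) {x s} →
           (∀ π → Candidate i ρ (filter P? V) π → score (zigzag π) x ≡ s) →
           Phase ((x , s) ∷ h) i ρ (filter P? V)
  refine P? answers = record
    { distinct = Unique.filter⁺ P? distinct
    ; fresh = All.filter⁺ P? fresh
    ; consistent = λ π cand@(below , inV) →
        answers π cand ∷
        consistent π (below , λ j i≤j j<2+i → proj₁ (∈-filter⁻ P? (inV j i≤j j<2+i)))
    }

  -- Puts p and q at the next two positions. Whatever follows them remains a candidate, which lets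
  -- the next phase start; exchanging p and q gives a second consistent secret.
  reveal : ∀ (a b : Fin n) → toℕ a ≡ i → toℕ b ≡ suc (toℕ a) →
           ∀ {p q} → p ∈ V → q ∈ V → p ≢ q →
           ∃[ σ ] Candidate i ρ V σ × σ ⟨$⟩ʳ a ≡ p ×
             (∀ π → AgreeBelow (2 + i) σ π → Candidate i ρ V π)
  reveal a b refl b≡1+a {p} {q} p∈V q∈V p≢q
    with placeTwo ρ a b p q b≡1+a p≢q (All.lookup fresh p∈V) (All.lookup fresh q∈V)
  ... | σ , below , σa≡p , σb≡q = σ , candidate σ (λ _ _ → refl) , σa≡p , candidate
    where
    candidate : ∀ π → AgreeBelow (2 + i) σ π → Candidate i ρ V π
    candidate π agree =
      (λ j j<i → trans (agree j (ℕ.m<n⇒m<1+n (ℕ.m<n⇒m<1+n j<i))) (below j j<i)) ,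
      λ j i≤j j<2+i → subst (_∈ V) (sym (agree j j<2+i)) (case ℕ.m≤n⇒m<n∨m≡n i≤j of λ where
        (inj₁ i<j) → subst (_∈ V)
          (trans (sym σb≡q) (cong (σ ⟨$⟩ʳ_) (Fin.toℕ-injective
            (trans b≡1+a (ℕ.≤-antisym i<j (ℕ.≤-pred j<2+i)))))) q∈V
        (inj₂ i≡j) → subst (_∈ V)
          (trans (sym σa≡p) (cong (σ ⟨$⟩ʳ_) (Fin.toℕ-injective i≡j))) p∈V)

  prefixRight? : ∀ x → Decidable (λ j → toℕ j < i → alternate (toℕ j) ≡ lookup x (ρ ⟨$⟩ʳ j))
  prefixRight? x j = (toℕ j ℕ.<? i) →-dec (alternate (toℕ j) Bool.≟ lookup x (ρ ⟨$⟩ʳ j))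

  answer : ∀ (a b : Fin n) → toℕ a ≡ i → toℕ b ≡ suc (toℕ a) →
           ∀ x {m} → m + m ≤ length V →
           ∃[ s ] ∃[ V′ ] Phase ((x , s) ∷ h) i ρ V′ × m ≤ length V′
  answer a b refl b≡1+a x {m} m+m≤V
    with Fin.all? (prefixRight? x)
  -- x errs within the revealed prefix: its first error fixes the score for all candidates, and V
  -- stays whole.
  ... | no ¬all with firstFailure (prefixRight? x) ¬all
  ...   | k , ¬pk , before = inject₁ k , V , record
          { distinct = distinct
          ; fresh = fresh
          ; consistent = λ π cand@(below , _) → score-zigzag π x k
              (λ j j<k → trans (before j j<k (ℕ.<-trans j<k k<i))
                (cong (lookup x) (sym (below j (ℕ.<-trans j<k k<i)))))
              (λ match → ¬pk λ _ → trans match (cong (lookup x) (below k k<i)))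
              ∷ consistent π cand
          } , ℕ.≤-trans (ℕ.m≤m+n m m) m+m≤V
    where
    k<i : toℕ k < i
    k<i = decidable-stable (toℕ k ℕ.<? i) (λ k≮i → ¬pk (λ k<i → contradiction k<i k≮i))
  answer a b refl b≡1+a x {m} m+m≤V | yes all =
    -- On the half passing `pass?`, x has the value required at a throughout, which is wrong at b;
    -- on the other half it is wrong at a already.
    case m+m≤p+q⇒m≤p⊎m≤q m _ _ (subst (m + m ≤_) (sym (length-filter-split pass? V)) m+m≤V) of λ where
      (inj₁ m≤) → inject₁ b , filter pass? V , refine pass? scoreᵇ , m≤
      (inj₂ m≤) → inject₁ a , filter (¬? ∘ pass?) V , refine (¬? ∘ pass?) scoreᵃ , m≤
    where
    pass? : Decidable (λ p → alternate (toℕ a) ≡ lookup x p)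
    pass? p = alternate (toℕ a) Bool.≟ lookup x p

    before : ∀ {π} → AgreeBelow i ρ π → ∀ j → toℕ j < i → alternate (toℕ j) ≡ lookup x (π ⟨$⟩ʳ j)
    before below j j<i = trans (all j j<i) (cong (lookup x) (sym (below j j<i)))

    passes : ∀ {P : Fin n → Set} {P? : Decidable P} {π} → Candidate i ρ (filter P? V) π →
             ∀ j → i ≤ toℕ j → toℕ j < 2 + i → P (π ⟨$⟩ʳ j)
    passes {P? = P?} (_ , inV) j i≤j j<2+i = proj₂ (∈-filter⁻ P? {xs = V} (inV j i≤j j<2+i))

    scoreᵃ : ∀ π → Candidate i ρ (filter (¬? ∘ pass?) V) π → score (zigzag π) x ≡ inject₁ a
    scoreᵃ π cand@(below , _) = score-zigzag π x a (before {π} below)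
      (passes {P? = ¬? ∘ pass?} {π} cand a ℕ.≤-refl (ℕ.m<n⇒m<1+n ℕ.≤-refl))

    scoreᵇ : ∀ π → Candidate i ρ (filter pass? V) π → score (zigzag π) x ≡ inject₁ b
    scoreᵇ π cand@(below , _) = score-zigzag π x b
      (λ j j<b → case ℕ.m≤n⇒m<n∨m≡n (ℕ.≤-pred (subst (toℕ j <_) b≡1+a j<b)) of λ where
        (inj₁ j<a) → before {π} below j j<a
        (inj₂ j≡a) → subst (λ j → alternate (toℕ j) ≡ lookup x (π ⟨$⟩ʳ j))
          (sym (Fin.toℕ-injective j≡a))
          (passes {P? = pass?} {π} cand a ℕ.≤-refl (ℕ.m<n⇒m<1+n ℕ.≤-refl)))
      (λ match → Bool.not-¬
        (sym (passes {P? = pass?} {π} cand b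
          (subst (i ≤_) (sym b≡1+a) (ℕ.n≤1+n i)) (ℕ.≤-reflexive (cong suc b≡1+a))))
        (trans (sym match) (cong alternate b≡1+a)))

-- Lower bound: counting queries over all phases.

consecutive : ∀ {i} → suc i < n → ∃[ a ] ∃[ b ] toℕ {n} a ≡ i × toℕ {n} b ≡ suc (toℕ a)
consecutive 1+i<n = fromℕ< i<n , fromℕ< 1+i<n , Fin.toℕ-fromℕ< i<n ,
  trans (Fin.toℕ-fromℕ< 1+i<n) (cong suc (sym (Fin.toℕ-fromℕ< i<n)))
  where i<n = ℕ.<-trans (ℕ.n<1+n _) 1+i<n

2≤2^[1+k] : ∀ k → 2 ≤ 2 ^ suc k
2≤2^[1+k] k = ℕ.^-monoʳ-≤ 2 {1} {suc k} (s≤s z≤n)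

next-room : ∀ M i {r} → suc M * 2 + i + r ≤ n → M * 2 + (2 + i) + r ≤ n
next-room {n} M i {r} = subst (λ l → l + r ≤ n)
  (sym (trans (ℕ.+-suc (M * 2) (suc i)) (cong suc (ℕ.+-suc (M * 2) i))))

-- k counts the halvings left in the current phase, M the phases of K halvings to come.
phase-lowerBound : ∀ K M k w {h : History n} {i ρ V} → Solvable w h → Phase h i ρ V →
                   2 ^ suc k ≤ length V → M * 2 + i + 2 ^ suc K ≤ n → k + M * K ≤ w
phase-lowerBound {n} K M k w {i = i} sol phase large room
  -- Since 2 ≤ 2^(1+K), the room guarantees that positions i and i + 1 exist.
  with consecutive (ℕ.≤-trans
         (subst (_≤ i + 2 ^ suc K) (ℕ.+-comm i 2) (ℕ.+-monoʳ-≤ i (2≤2^[1+k] K)))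
         (ℕ.≤-trans (ℕ.+-monoˡ-≤ (2 ^ suc K) (ℕ.m≤n+m i (M * 2))) room))
     | distinctPair (Phase.distinct phase) (ℕ.≤-trans (2≤2^[1+k] k) large)
phase-lowerBound K zero zero w sol phase large room | _ | _ = z≤n
-- No halvings are left, but V still has two elements: they are revealed and a new phase with k = K
-- opens, at no cost in queries.
phase-lowerBound {n} K (suc M) zero w {i = i} sol phase large room
  | a , b , a≡i , b≡1+a | p , q , p∈V , q∈V , p≢q
  with reveal phase a b a≡i b≡1+a p∈V q∈V p≢q
... | σ , _ , _ , candidate
  with newPhase {i = 2 + i} {σ} (2 ^ suc K)
         (ℕ.≤-trans (ℕ.+-monoˡ-≤ (2 ^ suc K) (ℕ.m≤n+m (2 + i) (M * 2))) (next-room M i room))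
         (λ π → Phase.consistent phase π ∘ candidate π)
... | V′ , phase′ , length≡ =
  phase-lowerBound K M K w sol phase′ (ℕ.≤-reflexive (sym length≡)) (next-room M i room)
-- No query is left, yet the orders p, q and q, p give two different consistent secrets.
phase-lowerBound K M (suc k) zero sol phase large room
  | a , b , a≡i , b≡1+a | p , q , p∈V , q∈V , p≢q
  with reveal phase a b a≡i b≡1+a p∈V q∈V p≢q | reveal phase a b a≡i b≡1+a q∈V p∈V (p≢q ∘ sym)
... | σ , σ-cand , σa≡p , _ | τ , τ-cand , τa≡q , _ =
  contradiction (trans (sym σa≡p) (trans (proj₂ σ≈τ a) τa≡q)) p≢q
  where
  σ≈τ : zigzag σ ≈ zigzag τ
  σ≈τ = sol (zigzag σ) (zigzag τ)
    (Phase.consistent phase σ σ-cand) (Phase.consistent phase τ τ-cand)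
phase-lowerBound K M (suc k) (suc w) {V = V} (x , sol) phase large room
  | a , b , a≡i , b≡1+a | _
  with answer phase a b a≡i b≡1+a x {2 ^ suc k}
         (subst (λ m → 2 ^ suc k + m ≤ length V) (ℕ.+-identityʳ _) large)
... | s , V′ , phase′ , large′ = s≤s (phase-lowerBound K M k w (sol s) phase′ large′ room)

-- There are M + 1 phases, each halving V from 2^(1+K) elements down to 2 in K queries. The last
-- starts at position 2M and still needs 2^(1+K) unplaced elements.
solvable-lowerBound : ∀ K M {w} → M * 2 + 2 ^ suc K ≤ n → Solvable {n} w [] → suc M * K ≤ w
solvable-lowerBound {n} K M {w} room sol
  with newPhase {h = []} {0} {Perm.id} (2 ^ suc K)
         (ℕ.≤-trans (ℕ.m≤n+m _ (M * 2)) room) (λ _ _ → [])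
... | V , phase , length≡ =
  phase-lowerBound K M K w sol phase (ℕ.≤-reflexive (sym length≡))
    (subst (λ l → l + 2 ^ suc K ≤ n) (sym (ℕ.+-identityʳ (M * 2))) room)

-- Logarithms and the two bounds of order n log n.

⌊n/2⌋*2≤n : ∀ n → ⌊ n /2⌋ * 2 ≤ n
⌊n/2⌋*2≤n zero = z≤n
⌊n/2⌋*2≤n (suc zero) = z≤n
⌊n/2⌋*2≤n (suc (suc n)) = s≤s (s≤s (⌊n/2⌋*2≤n n))

n≤1+⌊n/2⌋*2 : ∀ n → n ≤ 1 + ⌊ n /2⌋ * 2
n≤1+⌊n/2⌋*2 zero = z≤n
n≤1+⌊n/2⌋*2 (suc zero) = s≤s z≤n
n≤1+⌊n/2⌋*2 (suc (suc n)) = s≤s (s≤s (n≤1+⌊n/2⌋*2 n))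

n≤2^[1+⌊log₂n⌋] : ∀ n → n ≤ 2 ^ suc ⌊log₂ n ⌋
n≤2^[1+⌊log₂n⌋] n = ℕ.<⇒≤ (ℕ.≰⇒> λ 2^≤n → ℕ.1+n≰n
  (subst (_≤ ⌊log₂ n ⌋) (⌊log₂[2^n]⌋≡n (suc ⌊log₂ n ⌋)) (⌊log₂⌋-mono-≤ 2^≤n)))

≤⌊log₂⌋⇒2^≤ : ∀ k n → 1 ≤ n → k ≤ ⌊log₂ n ⌋ → 2 ^ k ≤ n
≤⌊log₂⌋⇒2^≤ zero n 1≤n _ = 1≤n
≤⌊log₂⌋⇒2^≤ (suc k) n@(suc (suc _)) _ 1+k≤log = begin
  2 * 2 ^ k      ≡⟨ ℕ.*-comm 2 (2 ^ k) ⟩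
  2 ^ k * 2      ≤⟨ ℕ.*-monoˡ-≤ 2 (≤⌊log₂⌋⇒2^≤ k ⌊ n /2⌋ (s≤s z≤n)
                      (subst (k ≤_) (sym (⌊log₂⌊n/2⌋⌋≡⌊log₂n⌋∸1 n)) (ℕ.∸-monoˡ-≤ 1 1+k≤log))) ⟩
  ⌊ n /2⌋ * 2    ≤⟨ ⌊n/2⌋*2≤n n ⟩
  n              ∎
  where open ℕ.≤-Reasoning

solvable-nlogn : ∀ n → Solvable {n} (n * (2 + ⌊log₂ n ⌋)) []
solvable-nlogn n =
  -- Per position, 1 + ⌊log₂ n⌋ probes find the digits and one the value.
  solvable-from (suc ⌊log₂ n ⌋) (n≤2^[1+⌊log₂n⌋] n) n 0 refl [] λ _ _ _ _ _ ()

-- Half of the positions hold the phases, the other half the supply of 2^(1+K) elements. With M + 1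
-- ≥ n/4 and K = ⌊log₂ n⌋ - 2 ≥ ⌊log₂ n⌋/2, the loss is a factor 4 · 2 = 8; the bound on K uses
-- ⌊log₂ n⌋ ≥ 4, that is, n ≥ 16.
nlogn≤8*solvable : ∀ n {w} → 16 ≤ n → Solvable {n} w [] → n * ⌊log₂ n ⌋ ≤ 8 * w
nlogn≤8*solvable n {w} 16≤n sol = begin
  n * ⌊log₂ n ⌋             ≤⟨ ℕ.*-mono-≤ n≤[1+M]*4 log≤K*2 ⟩
  suc M * 4 * (K * 2)       ≡⟨ rearrange (suc M) K ⟩
  8 * (suc M * K)           ≤⟨ ℕ.*-monoʳ-≤ 8 (solvable-lowerBound K M room sol) ⟩
  8 * w                     ∎
  where
  open ℕ.≤-Reasoning
  m = ⌊ n /2⌋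
  M = ⌊ m /2⌋
  K = ⌊log₂ n ⌋ ∸ 2

  4≤log : 4 ≤ ⌊log₂ n ⌋
  4≤log = subst (_≤ ⌊log₂ n ⌋) (⌊log₂[2^n]⌋≡n 4) (⌊log₂⌋-mono-≤ 16≤n)

  2+K≡log : 2 + K ≡ ⌊log₂ n ⌋
  2+K≡log = ℕ.m+[n∸m]≡n (ℕ.≤-trans (s≤s (s≤s z≤n)) 4≤log)

  log≤K*2 : ⌊log₂ n ⌋ ≤ K * 2
  log≤K*2 = begin
    ⌊log₂ n ⌋  ≡⟨ 2+K≡log ⟨
    2 + K      ≤⟨ ℕ.+-monoˡ-≤ K (ℕ.∸-monoˡ-≤ 2 4≤log) ⟩
    K + K      ≡⟨ cong (K +_) (ℕ.+-identityʳ K) ⟨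
    2 * K      ≡⟨ ℕ.*-comm 2 K ⟩
    K * 2      ∎

  n≤[1+M]*4 : n ≤ suc M * 4
  n≤[1+M]*4 = begin
    n                        ≤⟨ n≤1+⌊n/2⌋*2 n ⟩
    1 + m * 2                ≤⟨ s≤s (ℕ.*-monoˡ-≤ 2 (n≤1+⌊n/2⌋*2 m)) ⟩
    3 + M * 2 * 2            ≡⟨ cong (3 +_) (ℕ.*-assoc M 2 2) ⟩
    3 + M * 4                ≤⟨ ℕ.n≤1+n _ ⟩
    suc M * 4                ∎

  2^[1+K]≤m : 2 ^ suc K ≤ m
  2^[1+K]≤m = ≤⌊log₂⌋⇒2^≤ (suc K) m (ℕ.⌊n/2⌋-mono (ℕ.≤-trans (s≤s (s≤s z≤n)) 16≤n))
    (subst (suc K ≤_) (sym (⌊log₂⌊n/2⌋⌋≡⌊log₂n⌋∸1 n))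
      (ℕ.≤-reflexive (cong (_∸ 1) 2+K≡log)))

  room : M * 2 + 2 ^ suc K ≤ n
  room = begin
    M * 2 + 2 ^ suc K    ≤⟨ ℕ.+-mono-≤ (⌊n/2⌋*2≤n m) 2^[1+K]≤m ⟩
    m + m                ≡⟨ cong (m +_) (ℕ.+-identityʳ m) ⟨
    2 * m                ≡⟨ ℕ.*-comm 2 m ⟩
    m * 2                ≤⟨ ⌊n/2⌋*2≤n n ⟩
    n                    ∎

  rearrange : ∀ a b → a * 4 * (b * 2) ≡ 8 * (a * b)
  rearrange = solve-∀

theorem3p1 : ∃[ D ] (∀ n → IsQueryComplexity n (D n)) × D ∈Θ (λ n → n * ⌊log₂ n ⌋)
theorem3p1 =
  (λ n → proj₁ (D n)) ,
  (λ n → leastSolvable⇒queryComplexity (proj₁ (proj₂ (D n)))) ,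
  -- The 3 comes from 2 + l ≤ 3l for l = ⌊log₂ n⌋ ≥ 1; the 8 and the 16 come from the lower bound.
  8 , 3 , 16 , λ n 16≤n →
    nlogn≤8*solvable n 16≤n (proj₁ (proj₁ (proj₂ (D n)))) ,
    (begin
      proj₁ (D n)              ≤⟨ proj₂ (proj₂ (D n)) ⟩
      n * (2 + ⌊log₂ n ⌋)      ≤⟨ ℕ.*-monoʳ-≤ n (2+l≤l*3
                                    (⌊log₂⌋-mono-≤ {2} (ℕ.≤-trans (s≤s (s≤s z≤n)) 16≤n))) ⟩
      n * (⌊log₂ n ⌋ * 3)      ≡⟨ rearrange n ⌊log₂ n ⌋ ⟩
      3 * (n * ⌊log₂ n ⌋)      ∎)
  where
  open ℕ.≤-Reasoning

  D : ∀ n → ∃[ w ] IsLeast (λ w → Solvable {n} w []) w × w ≤ n * (2 + ⌊log₂ n ⌋)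
  D n = least (λ w → solvable? w []) (n * (2 + ⌊log₂ n ⌋)) (solvable-nlogn n)

  2+l≤l*3 : ∀ {l} → 1 ≤ l → 2 + l ≤ l * 3
  2+l≤l*3 {suc l} _ = s≤s (s≤s (s≤s (ℕ.m≤m*n l 3)))

  rearrange : ∀ a b → a * (b * 3) ≡ 3 * (a * b)
  rearrange = solve-∀
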